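{- Consider POWERSET MALIQUANT. The sequence starts at a heap of size one, and the first eight nim-values are, $0,0,1,0,2,1,4,8$. Otherwise, if $n=2k+1, k\ge 4$, then $\mathcal{SG}(n)=2^k$, and if $n\ge 10$ is even, then $\mathcal{SG}(n)=\mathcal{SG}(n/2)$.
   Context: POWERSET MALIQUANT is the impartial normal-play game on positive integer heaps where from a heap $n$ a player chooses any nonempty set of nondivisors $k$ of $n$ with $1\le k<n$ and moves to the disjunctive sum of those heaps; a heap with no such nondivisors is terminal. $\mathcal{SG}$ (nim-value) denotes the Sprague-Grundy value (mex rule, nim-sum). -}

module Defs where

open import Data.Fin.Base using (Fin; toℕ; splitAt)
open import Data.Fin.Properties using (toℕ<n)
open import Data.List.Base using (List; []; _∷_; [_]; _++_; map; foldr; filter; allFin; lookup; tabulate)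
open import Data.List.Membership.DecPropositional using () renaming (_∈?_ to member?)
open import Data.List.Membership.Propositional using (_∈_; _∉_)
open import Data.List.Relation.Unary.Any using (here; there)
open import Data.Nat.Base using (ℕ; zero; suc; _+_; _⊔_; _≤_; _<_; s≤s)
open import Data.Nat.Divisibility using (_∣?_)
open import Data.Nat.Induction using (<-rec)
open import Data.Nat.Properties using (_≟_; _≤?_; ≤-trans; ≤-reflexive; m≤m⊔n; m≤n⊔m; +-suc; +-identityʳ; <-irrefl; m<1+n⇒m<n∨m≡n)
open import Data.Sum.Base using ([_,_]′; inj₁; inj₂)
open import Relation.Binary.PropositionalEquality using (refl; sym)
open import Relation.Nullary.Decidable using (Dec; yes; no; _×-dec_; ¬?)

-- A finite impartial game is identified with its family of options.
data Game : Set where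
  node : ∀ {m} → (Fin m → Game) → Game

fromOptions : List Game → Game
fromOptions gs = node (lookup gs)

𝟘 : Game
𝟘 = fromOptions []

-- Disjunctive sum: a move is a move in exactly one of the two summands.
infixr 6 _⊕_
_⊕_ : Game → Game → Game
node {m} f ⊕ node {n} g =
  node {m + n} (λ i → [ (λ j → f j ⊕ node g) , (λ j → node f ⊕ g j) ]′ (splitAt m i))

⨁ : List Game → Game
⨁ = foldr _⊕_ 𝟘

_∈?_ : (k : ℕ) (xs : List ℕ) → Dec (k ∈ xs)
_∈?_ = member? _≟_

maximum : List ℕ → ℕ
maximum = foldr _⊔_ 0

searchFrom : (fuel k : ℕ) → List ℕ → ℕ
searchFrom zero       k xs = k
searchFrom (suc fuel) k xs with k ∈? xs
... | yes _ = searchFrom fuel (suc k) xs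
... | no  _ = k

-- The least natural number not in the list; the bound on the search is never
-- restrictive, see mex-∉ and mex-least.
mex : List ℕ → ℕ
mex xs = searchFrom (suc (maximum xs)) 0 xs

grundy : Game → ℕ
grundy (node f) = mex (tabulate (λ i → grundy (f i)))

-- All nonempty subsets of a list without repetitions.
nonemptySubsets : ∀ {A : Set} → List A → List (List A)
nonemptySubsets []       = []
nonemptySubsets (x ∷ xs) = [ x ] ∷ map (x ∷_) (nonemptySubsets xs) ++ nonemptySubsets xs

nondivisors : (n : ℕ) → List (Fin n)
nondivisors n = filter (λ k → (1 ≤? toℕ k) ×-dec ¬? (toℕ k ∣? n)) (allFin n)

-- A heap of size n in POWERSET MALIQUANT; the value at n = 0 is junk.
heap : ℕ → Game
heap = <-rec (λ _ → Game) λ n smallerHeap →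
  fromOptions (map (λ S → ⨁ (map (λ k → smallerHeap (toℕ<n k)) S))
                   (nonemptySubsets (nondivisors n)))

SG : ℕ → ℕ
SG n = grundy (heap n)

∈⇒≤maximum : ∀ {k} xs → k ∈ xs → k ≤ maximum xs
∈⇒≤maximum (x ∷ xs) (here refl) = m≤m⊔n x (maximum xs)
∈⇒≤maximum (x ∷ xs) (there p)   = ≤-trans (∈⇒≤maximum xs p) (m≤n⊔m x (maximum xs))

searchFrom-∉ : ∀ fuel k xs → maximum xs < fuel + k → searchFrom fuel k xs ∉ xs
searchFrom-∉ zero       k xs b p = <-irrefl refl (≤-trans b (∈⇒≤maximum xs p))
searchFrom-∉ (suc fuel) k xs b with k ∈? xs
... | yes _ = searchFrom-∉ fuel (suc k) xs (≤-trans b (≤-reflexive (sym (+-suc fuel k))))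
... | no ¬p = ¬p

searchFrom-least : ∀ fuel k xs → (∀ {j} → j < k → j ∈ xs) →
                   ∀ {j} → j < searchFrom fuel k xs → j ∈ xs
searchFrom-least zero       k xs below = below
searchFrom-least (suc fuel) k xs below with k ∈? xs
... | no  _   = below
... | yes k∈ = searchFrom-least fuel (suc k) xs below′
  where
  below′ : ∀ {j} → j < suc k → j ∈ xs
  below′ j<1+k with m<1+n⇒m<n∨m≡n j<1+k
  ... | inj₁ j<k  = below j<k
  ... | inj₂ refl = k∈

mex-∉ : ∀ xs → mex xs ∉ xs
mex-∉ xs = searchFrom-∉ (suc (maximum xs)) 0 xs (s≤s (≤-reflexive (sym (+-identityʳ _))))

mex-least : ∀ xs {j} → j < mex xs → j ∈ xs
mex-least xs = searchFrom-least (suc (maximum xs)) 0 xs λ ()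

{-# OPTIONS --safe #-}

-- The values of the options of n are the nim-sums of nonempty sets of values of
-- nondivisors. List the numbers 3, 5, 7, 8, 9, 11, 13, … as base 0, base 1, …;
-- every x ≥ 1 is either 1, 2 or 4, with value 0, or of the form base j * 2 ^ b, and
-- then its value is 2 ^ j. By induction, all values below n are 0 or powers of two,
-- so for n = base j * 2 ^ b three facts suffice.
--  * 2 ^ j is not the value of an option: a smaller number with the same base divides n.
--  * For i < j the greatest base i * 2 ^ c below n is a nondivisor: it is at least
--    n / 2, hence could only divide n by being n / 2, but n / 2 has the same base as
--    n or is not of this form at all.
--  * 0 is the value of an option: 2 is a nondivisor of value 0 when n is odd, and if
--    n = 2 * suc p then p and 2 * p are nondivisors of equal value, unless n is 6
--    or 10, where 4 has value 0.
module Submission where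

open import Data.Empty using (⊥)
open import Data.Fin.Base using (Fin; toℕ; fromℕ<; splitAt; _↑ˡ_; _↑ʳ_)
open import Data.Fin.Properties using (toℕ<n; toℕ-fromℕ<; splitAt-↑ˡ; splitAt-↑ʳ)
open import Data.List.Base using (List; []; _∷_; [_]; map; foldr; allFin; tabulate; lookup)
open import Data.List.Membership.Propositional using (_∈_; _∉_)
open import Data.List.Membership.Propositional.Properties using (∈-map⁺; ∈-map⁻; ∈-++⁺ˡ; ∈-++⁺ʳ; ∈-++⁻; ∈-tabulate⁺; ∈-tabulate⁻; ∈-filter⁺; ∈-filter⁻; ∈-allFin)
open import Data.List.Properties using (map-cong; map-∘; map-tabulate; tabulate-lookup)
open import Data.List.Relation.Unary.Any using (here; there)
open import Data.Nat.Base using (ℕ; _+_; _*_; _^_; _≤_; zero; suc; _<_; _∸_; z≤n; s≤s; z<s; ⌊_/2⌋; parity)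
open import Data.Nat.Divisibility using (_∣_; divides; _∣?_; ∣⇒≤; ∣m+n∣m⇒∣n; *-monoʳ-∣; n∣m*n; ∣-refl)
open import Data.Nat.DivMod using (_/_; m*n/n≡m)
open import Data.Nat.Induction using (<-rec; <-wellFounded)
open import Data.Nat.Properties
open import Data.Parity.Base using (Parity; 0ℙ; 1ℙ) renaming (_+_ to _+ᵖ_)
import Data.Parity.Properties as ℙ
open import Data.Product.Base using (_×_; ∃-syntax; _,_)
open import Data.Sum.Base using (_⊎_; inj₁; inj₂; [_,_]′)
open import Function.Base using (_∘_)
open import Induction.WellFounded using (module FixPoint)
open import Relation.Binary.Definitions using (tri<; tri≈; tri>)
open import Relation.Binary.PropositionalEquality using (_≡_; _≢_; refl; sym; trans; cong; cong₂; subst; subst₂; module ≡-Reasoning)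
open import Relation.Nullary.Decidable using (Dec; yes; no; from-yes; from-no; _×-dec_; ¬?)
open import Relation.Nullary.Negation using (¬_; contradiction)
open import Defs

-- Binary digits and nim-addition

bit : ℕ → ℕ → Parity
bit n zero    = parity n
bit n (suc i) = bit ⌊ n /2⌋ i

infixr 7 _◃_
-- Prepends a lowest binary digit. The form `2 * n` makes `2 ^ suc k` definitionally `0ℙ ◃ 2 ^ k`.
_◃_ : Parity → ℕ → ℕ
0ℙ ◃ n = 2 * n
1ℙ ◃ n = suc (2 * n)

2*-suc : ∀ n → 2 * suc n ≡ 2 + 2 * n
2*-suc n = cong suc (+-suc n (n + 0))

parity-◃ : ∀ p n → parity (p ◃ n) ≡ p
parity-◃ 0ℙ zero    = refl
parity-◃ 1ℙ zero    = refl
parity-◃ 0ℙ (suc n) rewrite +-suc n (n + 0) = parity-◃ 0ℙ n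
parity-◃ 1ℙ (suc n) rewrite +-suc n (n + 0) = parity-◃ 1ℙ n

half-◃ : ∀ p n → ⌊ p ◃ n /2⌋ ≡ n
half-◃ 0ℙ zero    = refl
half-◃ 1ℙ zero    = refl
half-◃ 0ℙ (suc n) rewrite +-suc n (n + 0) = cong suc (half-◃ 0ℙ n)
half-◃ 1ℙ (suc n) rewrite +-suc n (n + 0) = cong suc (half-◃ 1ℙ n)

◃-suc : ∀ p n → p ◃ suc n ≡ 2 + p ◃ n
◃-suc 0ℙ n = 2*-suc n
◃-suc 1ℙ n = cong suc (2*-suc n)

parity◃half : ∀ n → n ≡ parity n ◃ ⌊ n /2⌋
parity◃half 0             = refl
parity◃half 1             = refl
parity◃half (suc (suc n)) = trans (cong (2 +_) (parity◃half n)) (sym (◃-suc (parity n) ⌊ n /2⌋))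

half-≤ : ∀ {n f} → n ≤ suc f → ⌊ n /2⌋ ≤ f
half-≤ {zero}  _   = z≤n
half-≤ {suc n} n≤f = ≤-pred (≤-trans (⌊n/2⌋<n n) n≤f)

bit-zero : ∀ i → bit 0 i ≡ 0ℙ
bit-zero zero    = refl
bit-zero (suc i) = bit-zero i

-- Halving is no structural descent, so the induction runs on a common bound `f` of both numbers.
-- This lemma lets every law of `_⊻_` be read off digit by digit from addition of parities.
bit-injective : ∀ {a b} → (∀ i → bit a i ≡ bit b i) → a ≡ b
bit-injective {a} {b} = go (a + b) a b (m≤m+n a b) (m≤n+m b a)
  where
  go : ∀ f a b → a ≤ f → b ≤ f → (∀ i → bit a i ≡ bit b i) → a ≡ b
  go zero    zero zero _   _   _  = refl
  go (suc f) a    b    a≤f b≤f eq = begin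
    a                    ≡⟨ parity◃half a ⟩
    parity a ◃ ⌊ a /2⌋   ≡⟨ cong₂ _◃_ (eq 0) (go f _ _ (half-≤ a≤f) (half-≤ b≤f) (eq ∘ suc)) ⟩
    parity b ◃ ⌊ b /2⌋   ≡⟨ parity◃half b ⟨
    b                    ∎
    where open ≡-Reasoning

-- The fuel bounds the number of binary digits.
xor : (fuel a b : ℕ) → ℕ
xor zero       a b = 0
xor (suc fuel) a b = (parity a +ᵖ parity b) ◃ xor fuel ⌊ a /2⌋ ⌊ b /2⌋

infixl 6 _⊻_
_⊻_ : ℕ → ℕ → ℕ
a ⊻ b = xor (a + b) a b

bit-xor : ∀ f a b → a ≤ f → b ≤ f → ∀ i → bit (xor f a b) i ≡ bit a i +ᵖ bit b i
bit-xor zero    zero zero _   _   i       = trans (bit-zero i) (sym (cong₂ _+ᵖ_ (bit-zero i) (bit-zero i)))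
bit-xor (suc f) a    b    _   _   zero    = parity-◃ (parity a +ᵖ parity b) _
bit-xor (suc f) a    b    a≤f b≤f (suc i) =
  trans (cong (λ n → bit n i) (half-◃ (parity a +ᵖ parity b) _))
        (bit-xor f ⌊ a /2⌋ ⌊ b /2⌋ (half-≤ a≤f) (half-≤ b≤f) i)

bit-⊻ : ∀ a b i → bit (a ⊻ b) i ≡ bit a i +ᵖ bit b i
bit-⊻ a b = bit-xor (a + b) a b (m≤m+n a b) (m≤n+m b a)

⊻-comm : ∀ a b → a ⊻ b ≡ b ⊻ a
⊻-comm a b = bit-injective λ i →
  trans (bit-⊻ a b i) (trans (ℙ.+-comm (bit a i) (bit b i)) (sym (bit-⊻ b a i)))

⊻-assoc : ∀ a b c → (a ⊻ b) ⊻ c ≡ a ⊻ (b ⊻ c)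
⊻-assoc a b c = bit-injective λ i → begin
  bit (a ⊻ b ⊻ c) i                  ≡⟨ bit-⊻ (a ⊻ b) c i ⟩
  bit (a ⊻ b) i +ᵖ bit c i           ≡⟨ cong (_+ᵖ bit c i) (bit-⊻ a b i) ⟩
  bit a i +ᵖ bit b i +ᵖ bit c i      ≡⟨ ℙ.+-assoc (bit a i) (bit b i) (bit c i) ⟩
  bit a i +ᵖ (bit b i +ᵖ bit c i)    ≡⟨ cong (bit a i +ᵖ_) (bit-⊻ b c i) ⟨
  bit a i +ᵖ bit (b ⊻ c) i           ≡⟨ bit-⊻ a (b ⊻ c) i ⟨
  bit (a ⊻ (b ⊻ c)) i                ∎
  where open ≡-Reasoning

⊻-identityʳ : ∀ a → a ⊻ 0 ≡ a
⊻-identityʳ a = bit-injective λ i →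
  trans (bit-⊻ a 0 i) (trans (cong (bit a i +ᵖ_) (bit-zero i)) (ℙ.+-identityʳ (bit a i)))

⊻-identityˡ : ∀ a → 0 ⊻ a ≡ a
⊻-identityˡ a = trans (⊻-comm 0 a) (⊻-identityʳ a)

⊻-self : ∀ a → a ⊻ a ≡ 0
⊻-self a = bit-injective λ i →
  trans (bit-⊻ a a i) (trans (ℙ.p+p≡0ℙ (bit a i)) (sym (bit-zero i)))

⊻-involutiveʳ : ∀ a b → (a ⊻ b) ⊻ b ≡ a
⊻-involutiveʳ a b = trans (⊻-assoc a b b) (trans (cong (a ⊻_) (⊻-self b)) (⊻-identityʳ a))

⊻-involutiveˡ : ∀ a b → a ⊻ (a ⊻ b) ≡ b
⊻-involutiveˡ a b = trans (sym (⊻-assoc a a b)) (trans (cong (_⊻ b) (⊻-self a)) (⊻-identityˡ b))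

⊻-cancelʳ : ∀ {a b} c → a ⊻ c ≡ b ⊻ c → a ≡ b
⊻-cancelʳ {a} {b} c eq = trans (sym (⊻-involutiveʳ a c)) (trans (cong (_⊻ c) eq) (⊻-involutiveʳ b c))

⊻-cancelˡ : ∀ a {b c} → a ⊻ b ≡ a ⊻ c → b ≡ c
⊻-cancelˡ a {b} {c} eq = trans (sym (⊻-involutiveˡ a b)) (trans (cong (a ⊻_) eq) (⊻-involutiveˡ a c))

-- Nim-addition and the order

half-⊻ : ∀ a b → ⌊ a ⊻ b /2⌋ ≡ ⌊ a /2⌋ ⊻ ⌊ b /2⌋
half-⊻ a b = bit-injective λ i → trans (bit-⊻ a b (suc i)) (sym (bit-⊻ ⌊ a /2⌋ ⌊ b /2⌋ i))

half-<⇒< : ∀ {a b} → ⌊ a /2⌋ < ⌊ b /2⌋ → a < b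
half-<⇒< lt = ≰⇒> λ b≤a → <⇒≱ lt (⌊n/2⌋-mono b≤a)

parity-<⇒< : ∀ {a b} → ⌊ a /2⌋ ≡ ⌊ b /2⌋ → parity a ≡ 0ℙ → parity b ≡ 1ℙ → a < b
parity-<⇒< {a} {b} h pa pb = ≤-reflexive (begin
  suc a                       ≡⟨ cong suc (parity◃half a) ⟩
  suc (parity a ◃ ⌊ a /2⌋)    ≡⟨ cong₂ (λ p n → suc (p ◃ n)) pa h ⟩
  1ℙ ◃ ⌊ b /2⌋                ≡⟨ cong (_◃ ⌊ b /2⌋) pb ⟨
  parity b ◃ ⌊ b /2⌋          ≡⟨ parity◃half b ⟨
  b                           ∎)
  where open ≡-Reasoning

<⇒half-<⊎parity-< : ∀ {a b} → a < b →
  ⌊ a /2⌋ < ⌊ b /2⌋ ⊎ (⌊ a /2⌋ ≡ ⌊ b /2⌋ × parity a ≡ 0ℙ × parity b ≡ 1ℙ)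
<⇒half-<⊎parity-< {a} {b} a<b with m≤n⇒m<n∨m≡n (⌊n/2⌋-mono (<⇒≤ a<b))
... | inj₁ lt = inj₁ lt
... | inj₂ h  = inj₂ (h , parities (parity a) (parity b) refl refl)
  where
  a≢b : parity a ≢ parity b
  a≢b p = <⇒≢ a<b (trans (parity◃half a) (trans (cong₂ _◃_ p h) (sym (parity◃half b))))

  parities : ∀ p q → parity a ≡ p → parity b ≡ q → parity a ≡ 0ℙ × parity b ≡ 1ℙ
  parities 0ℙ 1ℙ pa pb = pa , pb
  parities 1ℙ 0ℙ pa pb = contradiction (parity-<⇒< (sym h) pb pa) (<-asym a<b)
  parities 0ℙ 0ℙ pa pb = contradiction (trans pa (sym pb)) a≢b
  parities 1ℙ 1ℙ pa pb = contradiction (trans pa (sym pb)) a≢b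

-- At the highest digit where `c` and `a ⊻ b` differ, the latter has a 1, so exactly one of `a` and
-- `b` has a 1 there. Replacing that one as stated clears this digit and keeps all higher ones. The
-- recursion on halves locates the digit.
<-⊻ : ∀ {a b c} → c < a ⊻ b → c ⊻ b < a ⊎ a ⊻ c < b
<-⊻ {a} {b} {c} = go (a ⊻ b) a b c ≤-refl
  where
  go : ∀ f a b c → a ⊻ b ≤ f → c < a ⊻ b → c ⊻ b < a ⊎ a ⊻ c < b
  go zero    a b c bound lt = contradiction (≤-trans lt bound) λ ()
  go (suc f) a b c bound lt with <⇒half-<⊎parity-< lt
  ... | inj₁ h with go f ⌊ a /2⌋ ⌊ b /2⌋ ⌊ c /2⌋
                      (subst (_≤ f) (half-⊻ a b) (half-≤ bound))
                      (subst (⌊ c /2⌋ <_) (half-⊻ a b) h)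
  ...   | inj₁ l = inj₁ (half-<⇒< (subst (_< ⌊ a /2⌋) (sym (half-⊻ c b)) l))
  ...   | inj₂ r = inj₂ (half-<⇒< (subst (_< ⌊ b /2⌋) (sym (half-⊻ a c)) r))
  -- The halves agree, so the last digit decides. The third scrutinee says that the parities of `a`
  -- and `b` add up to 1, which rules out equal parities.
  go (suc f) a b c bound lt | inj₂ (h , pc , pab) with parity a in pa | parity b in pb | trans (sym (bit-⊻ a b 0)) pab
  ...   | 1ℙ | 0ℙ | _ = inj₁ (parity-<⇒< half-eq (trans (bit-⊻ c b 0) (cong₂ _+ᵖ_ pc pb)) pa)
    where
    half-eq : ⌊ c ⊻ b /2⌋ ≡ ⌊ a /2⌋
    half-eq = trans (half-⊻ c b)
      (trans (cong (_⊻ ⌊ b /2⌋) (trans h (half-⊻ a b))) (⊻-involutiveʳ ⌊ a /2⌋ ⌊ b /2⌋))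
  ...   | 0ℙ | 1ℙ | _ = inj₂ (parity-<⇒< half-eq (trans (bit-⊻ a c 0) (cong₂ _+ᵖ_ pa pc)) pb)
    where
    half-eq : ⌊ a ⊻ c /2⌋ ≡ ⌊ b /2⌋
    half-eq = trans (half-⊻ a c)
      (trans (cong (⌊ a /2⌋ ⊻_) (trans h (half-⊻ a b))) (⊻-involutiveˡ ⌊ a /2⌋ ⌊ b /2⌋))

-- Binary digits and powers of two

bit-2^-same : ∀ k → bit (2 ^ k) k ≡ 1ℙ
bit-2^-same zero    = refl
bit-2^-same (suc k) = trans (cong (λ n → bit n k) (half-◃ 0ℙ (2 ^ k))) (bit-2^-same k)

bit-2^-other : ∀ k i → k ≢ i → bit (2 ^ k) i ≡ 0ℙ
bit-2^-other zero    zero    k≢i = contradiction refl k≢i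
bit-2^-other zero    (suc i) k≢i = bit-zero i
bit-2^-other (suc k) zero    k≢i = parity-◃ 0ℙ (2 ^ k)
bit-2^-other (suc k) (suc i) k≢i =
  trans (cong (λ n → bit n i) (half-◃ 0ℙ (2 ^ k))) (bit-2^-other k i (k≢i ∘ cong suc))

2^-injective : ∀ {i j} → 2 ^ i ≡ 2 ^ j → i ≡ j
2^-injective {i} {j} eq with i ≟ j
... | yes i≡j = i≡j
... | no  i≢j with () ← trans (sym (bit-2^-same j)) (trans (sym (cong (λ n → bit n j) eq)) (bit-2^-other i j i≢j))

<2^⇒bit≡0 : ∀ k {v} → v < 2 ^ k → ∀ {i} → k ≤ i → bit v i ≡ 0ℙ
<2^⇒bit≡0 zero    {zero}  _   {i}     _         = bit-zero i
<2^⇒bit≡0 zero    {suc v} (s≤s ())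
<2^⇒bit≡0 (suc k) {v}     lt  {suc i} (s≤s k≤i) = <2^⇒bit≡0 k half< k≤i
  where
  half< : ⌊ v /2⌋ < 2 ^ k
  half< = ≰⇒> λ le → <⇒≱ lt (≤-trans (*-monoʳ-≤ 2 le) 2*half≤)
    where
    ◃-≥ : ∀ p n → 2 * n ≤ p ◃ n
    ◃-≥ 0ℙ n = ≤-refl
    ◃-≥ 1ℙ n = n≤1+n (2 * n)
    2*half≤ : 2 * ⌊ v /2⌋ ≤ v
    2*half≤ = subst (2 * ⌊ v /2⌋ ≤_) (sym (parity◃half v)) (◃-≥ (parity v) ⌊ v /2⌋)

-- Sprague–Grundy theory

mex-unique : ∀ {xs v} → v ∉ xs → (∀ {j} → j < v → j ∈ xs) → mex xs ≡ v
mex-unique {xs} {v} v∉ below with <-cmp (mex xs) v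
... | tri< lt _ _ = contradiction (below lt) (mex-∉ xs)
... | tri≈ _ eq _ = eq
... | tri> _ _ gt = contradiction (mex-least xs gt) v∉

grundy-unique : ∀ {m v} (f : Fin m → Game) → (∀ i → grundy (f i) ≢ v) →
                (∀ {j} → j < v → ∃[ i ] grundy (f i) ≡ j) → grundy (node f) ≡ v
grundy-unique f avoid reach = mex-unique
  (λ v∈ → let i , eq = ∈-tabulate⁻ v∈ in avoid i (sym eq))
  (λ j<v → let i , eq = reach j<v in subst (_∈ _) eq (∈-tabulate⁺ i))

grundy-option-≢ : ∀ {m} (f : Fin m → Game) i → grundy (f i) ≢ grundy (node f)
grundy-option-≢ f i eq = mex-∉ _ (subst (_∈ tabulate (grundy ∘ f)) eq (∈-tabulate⁺ i))

grundy-below : ∀ {m} (f : Fin m → Game) {j} → j < grundy (node f) → ∃[ i ] grundy (f i) ≡ j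
grundy-below f lt = let i , eq = ∈-tabulate⁻ (mex-least _ lt) in i , sym eq

-- Cancellation in `_⊻_` keeps the options away from the claimed value, and `<-⊻` tells in which
-- summand to move to reach a smaller one. The induction hypotheses are arguments, so that the
-- recursion in `grundy-⊕` is visibly structural.
grundy-⊕-step : ∀ {m n} (f : Fin m → Game) (g : Fin n → Game) →
  (∀ i → grundy (f i ⊕ node g) ≡ grundy (f i) ⊻ grundy (node g)) →
  (∀ j → grundy (node f ⊕ g j) ≡ grundy (node f) ⊻ grundy (g j)) →
  grundy (node f ⊕ node g) ≡ grundy (node f) ⊻ grundy (node g)
grundy-⊕-step {m} {n} f g ihˡ ihʳ =
  grundy-unique (λ i → option (splitAt m i)) (λ i → avoid (splitAt m i)) reach
  where
  option : Fin m ⊎ Fin n → Game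
  option = [ (λ i → f i ⊕ node g) , (λ j → node f ⊕ g j) ]′

  avoid : ∀ s → grundy (option s) ≢ grundy (node f) ⊻ grundy (node g)
  avoid (inj₁ i) eq = grundy-option-≢ f i (⊻-cancelʳ (grundy (node g)) (trans (sym (ihˡ i)) eq))
  avoid (inj₂ j) eq = grundy-option-≢ g j (⊻-cancelˡ (grundy (node f)) (trans (sym (ihʳ j)) eq))

  reach : ∀ {c} → c < grundy (node f) ⊻ grundy (node g) → ∃[ i ] grundy (option (splitAt m i)) ≡ c
  reach {c} lt with <-⊻ {grundy (node f)} {grundy (node g)} lt
  ... | inj₁ l = let i , eq = grundy-below f l in i ↑ˡ n ,
    trans (cong (grundy ∘ option) (splitAt-↑ˡ m i n))
      (trans (ihˡ i) (trans (cong (_⊻ grundy (node g)) eq) (⊻-involutiveʳ c (grundy (node g)))))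
  ... | inj₂ r = let j , eq = grundy-below g r in m ↑ʳ j ,
    trans (cong (grundy ∘ option) (splitAt-↑ʳ m n j))
      (trans (ihʳ j) (trans (cong (grundy (node f) ⊻_) eq) (⊻-involutiveˡ (grundy (node f)) c)))

grundy-⊕ : ∀ G H → grundy (G ⊕ H) ≡ grundy G ⊻ grundy H
grundy-⊕ (node f) (node g) =
  grundy-⊕-step f g (λ i → grundy-⊕ (f i) (node g)) (λ j → grundy-⊕ (node f) (g j))

⨊ : ∀ {A : Set} → (A → ℕ) → List A → ℕ
⨊ w = foldr (λ x v → w x ⊻ v) 0

grundy-⨁ : ∀ {A : Set} (h : A → Game) xs → grundy (⨁ (map h xs)) ≡ ⨊ (grundy ∘ h) xs
grundy-⨁ h []       = refl
grundy-⨁ h (x ∷ xs) = trans (grundy-⊕ (h x) (⨁ (map h xs))) (cong (grundy (h x) ⊻_) (grundy-⨁ h xs))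

grundy-fromOptions : ∀ gs → grundy (fromOptions gs) ≡ mex (map grundy gs)
grundy-fromOptions gs = cong mex
  (trans (sym (map-tabulate (lookup gs) grundy)) (cong (map grundy) (tabulate-lookup gs)))

-- Well-founded recursion does not unfold by computation at a variable `n`. The unfolding lemma asks
-- that the recursion step respect pointwise equality of recursive results, which `map-cong`
-- provides.
heap-unfold : ∀ n → heap n ≡ fromOptions (map (λ S → ⨁ (map (heap ∘ toℕ) S)) (nonemptySubsets (nondivisors n)))
heap-unfold n = FixPoint.unfold-wfRec <-wellFounded (λ _ → Game) _
  (λ m eq → cong fromOptions
    (map-cong (λ S → cong ⨁ (map-cong (λ k → eq (toℕ<n k)) S)) (nonemptySubsets (nondivisors m))))
  {n}

SG-mex : ∀ n → SG n ≡ mex (map (⨊ (SG ∘ toℕ)) (nonemptySubsets (nondivisors n)))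
SG-mex n = begin
  grundy (heap n)                                           ≡⟨ cong grundy (heap-unfold n) ⟩
  grundy (fromOptions (map _ subsets))                      ≡⟨ grundy-fromOptions (map (λ S → ⨁ (map (heap ∘ toℕ) S)) subsets) ⟩
  mex (map grundy (map (λ S → ⨁ (map (heap ∘ toℕ) S)) subsets))
    ≡⟨ cong mex (map-∘ subsets) ⟨
  mex (map (λ S → grundy (⨁ (map (heap ∘ toℕ) S))) subsets)
    ≡⟨ cong mex (map-cong (grundy-⨁ (heap ∘ toℕ)) subsets) ⟩
  mex (map (⨊ (SG ∘ toℕ)) subsets)                          ∎
  where
  open ≡-Reasoning
  subsets = nonemptySubsets (nondivisors n)

-- Nim-sums over nonempty subsets

module _ {A : Set} where

  nonemptySubsets-[x] : ∀ {x : A} {xs} → x ∈ xs → [ x ] ∈ nonemptySubsets xs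
  nonemptySubsets-[x] (here refl) = here refl
  nonemptySubsets-[x] (there p)   = there (∈-++⁺ʳ _ (nonemptySubsets-[x] p))

  -- Subsets inherit the order of `xs`, so which of the two lists occurs depends on which element
  -- comes first.
  nonemptySubsets-[x,y] : ∀ {x y : A} {xs} → x ≢ y → x ∈ xs → y ∈ xs →
    (x ∷ y ∷ []) ∈ nonemptySubsets xs ⊎ (y ∷ x ∷ []) ∈ nonemptySubsets xs
  nonemptySubsets-[x,y] x≢y (here refl) (here refl) = contradiction refl x≢y
  nonemptySubsets-[x,y] x≢y (here refl) (there q)   = inj₁ (there (∈-++⁺ˡ (∈-map⁺ _ (nonemptySubsets-[x] q))))
  nonemptySubsets-[x,y] x≢y (there p)   (here refl) = inj₂ (there (∈-++⁺ˡ (∈-map⁺ _ (nonemptySubsets-[x] p))))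
  nonemptySubsets-[x,y] x≢y (there p)   (there q)   with nonemptySubsets-[x,y] x≢y p q
  ... | inj₁ r = inj₁ (there (∈-++⁺ʳ _ r))
  ... | inj₂ r = inj₂ (there (∈-++⁺ʳ _ r))

  module _ (w : A → ℕ) where

    -- The nim-sums over all subsets, the empty one included: the span of the weights over the field
    -- with two elements.
    data Span : List A → ℕ → Set where
      []   : Span [] 0
      keep : ∀ {x xs v} → Span xs v → Span (x ∷ xs) (w x ⊻ v)
      skip : ∀ {x xs v} → Span xs v → Span (x ∷ xs) v

    Span-0 : ∀ xs → Span xs 0
    Span-0 []       = []
    Span-0 (x ∷ xs) = skip (Span-0 xs)

    Span-∈ : ∀ {x xs} → x ∈ xs → Span xs (w x)
    Span-∈ {xs = x ∷ xs} (here refl) = subst (Span _) (⊻-identityʳ (w x)) (keep (Span-0 xs))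
    Span-∈               (there p)   = skip (Span-∈ p)

    -- The symmetric difference of the two subsets works: an element kept in both contributes
    -- `w x ⊻ w x`, which is 0.
    Span-⊻ : ∀ {xs u v} → Span xs u → Span xs v → Span xs (u ⊻ v)
    Span-⊻ [] [] = []
    Span-⊻ (skip s) (skip t) = skip (Span-⊻ s t)
    Span-⊻ (keep {x} {v = u} s) (skip {v = v} t) =
      subst (Span _) (sym (⊻-assoc (w x) u v)) (keep (Span-⊻ s t))
    Span-⊻ (skip {v = u} s) (keep {x} {v = v} t) =
      subst (Span _) (trans (cong (w x ⊻_) (⊻-comm u v)) (trans (sym (⊻-assoc (w x) v u)) (⊻-comm (w x ⊻ v) u)))
        (keep (Span-⊻ s t))
    Span-⊻ (keep {x} {v = u} s) (keep {v = v} t) = subst (Span _) eq (skip (Span-⊻ s t))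
      where
      eq : u ⊻ v ≡ (w x ⊻ u) ⊻ (w x ⊻ v)
      eq = trans (cong (_⊻ v) (trans (sym (⊻-involutiveʳ u (w x))) (cong (_⊻ w x) (⊻-comm u (w x)))))
                 (⊻-assoc (w x ⊻ u) (w x) v)

    -- The weights `2 ^ j` are the unit vectors of the first `k` binary digits; the digits of `v`
    -- are removed from the top down.
    Span-bits : ∀ {xs} k → (∀ {j} → j < k → ∃[ x ] x ∈ xs × w x ≡ 2 ^ j) →
                ∀ v → (∀ {i} → k ≤ i → bit v i ≡ 0ℙ) → Span xs v
    Span-bits {xs} zero gen v high =
      subst (Span xs) (bit-injective λ i → trans (bit-zero i) (sym (high {i} z≤n))) (Span-0 xs)
    Span-bits {xs} (suc k) gen v high with bit v k in vk
    ... | 0ℙ = Span-bits k (gen ∘ m<n⇒m<1+n) v high′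
      where
      high′ : ∀ {i} → k ≤ i → bit v i ≡ 0ℙ
      high′ k≤i with m≤n⇒m<n∨m≡n k≤i
      ... | inj₁ k<i  = high k<i
      ... | inj₂ refl = vk
    -- Nim-adding `2 ^ k` clears digit `k`; the generator of that weight then restores it.
    ... | 1ℙ = let x , x∈ , wx = gen ≤-refl in
      subst (Span xs) (⊻-involutiveʳ v (2 ^ k))
        (Span-⊻ (Span-bits k (gen ∘ m<n⇒m<1+n) (v ⊻ 2 ^ k) high′) (subst (Span xs) wx (Span-∈ x∈)))
      where
      high′ : ∀ {i} → k ≤ i → bit (v ⊻ 2 ^ k) i ≡ 0ℙ
      high′ {i} k≤i with m≤n⇒m<n∨m≡n k≤i
      ... | inj₁ k<i  = trans (bit-⊻ v (2 ^ k) i) (cong₂ _+ᵖ_ (high k<i) (bit-2^-other k i (<⇒≢ k<i)))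
      ... | inj₂ refl = trans (bit-⊻ v (2 ^ k) k) (cong₂ _+ᵖ_ vk (bit-2^-same k))

    -- Passing to nonempty subsets can lose only the value 0.
    Span⇒nonemptySubset : ∀ {xs v} → Span xs v → v ≡ 0 ⊎ v ∈ map (⨊ w) (nonemptySubsets xs)
    Span⇒nonemptySubset s with subset s
      where
      subset : ∀ {xs v} → Span xs v → v ≡ 0 ⊎ (∃[ S ] S ∈ nonemptySubsets xs × v ≡ ⨊ w S)
      subset [] = inj₁ refl
      subset (skip s) with subset s
      ... | inj₁ v≡0          = inj₁ v≡0
      ... | inj₂ (S , S∈ , e) = inj₂ (S , there (∈-++⁺ʳ _ S∈) , e)
      subset (keep {x} s) with subset s
      ... | inj₁ v≡0          = inj₂ ([ x ] , here refl , cong (w x ⊻_) v≡0)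
      ... | inj₂ (S , S∈ , e) = inj₂ (x ∷ S , there (∈-++⁺ˡ (∈-map⁺ (x ∷_) S∈)) , cong (w x ⊻_) e)
    ... | inj₁ v≡0          = inj₁ v≡0
    ... | inj₂ (S , S∈ , e) = inj₂ (subst (_∈ _) (sym e) (∈-map⁺ (⨊ w) S∈))

    bit-⨊ : ∀ k xs → (∀ {x} → x ∈ xs → bit (w x) k ≡ 0ℙ) →
            ∀ {S} → S ∈ nonemptySubsets xs → bit (⨊ w S) k ≡ 0ℙ
    bit-⨊ k (x ∷ xs) low (here refl) =
      trans (bit-⊻ (w x) 0 k) (cong₂ _+ᵖ_ (low (here refl)) (bit-zero k))
    bit-⨊ k (x ∷ xs) low (there p) with ∈-++⁻ (map (x ∷_) (nonemptySubsets xs)) p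
    ... | inj₂ q = bit-⨊ k xs (low ∘ there) q
    ... | inj₁ q with T , T∈ , refl ← ∈-map⁻ (x ∷_) q =
      trans (bit-⊻ (w x) (⨊ w T) k) (cong₂ _+ᵖ_ (low (here refl)) (bit-⨊ k xs (low ∘ there) T∈))

-- Values of POWERSET MALIQUANT

record Nondivisor (n x : ℕ) : Set where
  constructor nondivisor
  field
    positive : 1 ≤ x
    smaller  : x < n
    nondivides : ¬ x ∣ n

open Nondivisor

isNondivisor? : ∀ n (i : Fin n) → Dec (1 ≤ toℕ i × ¬ toℕ i ∣ n)
isNondivisor? n i = (1 ≤? toℕ i) ×-dec ¬? (toℕ i ∣? n)

∈-nondivisors⁺ : ∀ {n x} → Nondivisor n x → ∃[ i ] i ∈ nondivisors n × toℕ i ≡ x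
∈-nondivisors⁺ {n} {x} (nondivisor 1≤x x<n x∤n) = fromℕ< x<n ,
  ∈-filter⁺ (isNondivisor? n) (∈-allFin _) (subst (1 ≤_) (sym eq) 1≤x , x∤n ∘ subst (_∣ n) eq) , eq
  where
  eq : toℕ (fromℕ< x<n) ≡ x
  eq = toℕ-fromℕ< x<n

∈-nondivisors⁻ : ∀ {n} {i : Fin n} → i ∈ nondivisors n → Nondivisor n (toℕ i)
∈-nondivisors⁻ {n} {i} p =
  let _ , 1≤i , i∤n = ∈-filter⁻ (isNondivisor? n) {xs = allFin n} p in nondivisor 1≤i (toℕ<n i) i∤n

-- The two kinds of witness used for an option of value 0, the one value that `Span` cannot
-- guarantee for a nonempty subset.
data Cancelling (n : ℕ) : Set where
  zero-option : ∀ x → Nondivisor n x → SG x ≡ 0 → Cancelling n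
  equal-pair  : ∀ x y → x ≢ y → Nondivisor n x → Nondivisor n y → SG x ≡ SG y → Cancelling n

Cancelling⇒0∈ : ∀ {n} → Cancelling n → 0 ∈ map (⨊ (SG ∘ toℕ)) (nonemptySubsets (nondivisors n))
Cancelling⇒0∈ (zero-option x nd eq) with i , i∈ , refl ← ∈-nondivisors⁺ nd =
  subst (_∈ _) (trans (⊻-identityʳ (SG (toℕ i))) eq)
    (∈-map⁺ (⨊ (SG ∘ toℕ)) (nonemptySubsets-[x] i∈))
Cancelling⇒0∈ {n} (equal-pair x y x≢y nx ny eq)
  with i , i∈ , refl ← ∈-nondivisors⁺ nx | j , j∈ , refl ← ∈-nondivisors⁺ ny
  = [ (λ p → subst (_∈ _) (pair≡0 i j eq) (∈-map⁺ (⨊ (SG ∘ toℕ)) p))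
    , (λ p → subst (_∈ _) (pair≡0 j i (sym eq)) (∈-map⁺ (⨊ (SG ∘ toℕ)) p))
    ]′ (nonemptySubsets-[x,y] (x≢y ∘ cong toℕ) i∈ j∈)
  where
  pair≡0 : ∀ (i j : Fin n) → SG (toℕ i) ≡ SG (toℕ j) → ⨊ (SG ∘ toℕ) (i ∷ j ∷ []) ≡ 0
  pair≡0 i j eq = trans (cong₂ _⊻_ eq (⊻-identityʳ (SG (toℕ j)))) (⊻-self (SG (toℕ j)))

-- Digits add under `_⊻_`, so digit `k` vanishes in every option value and `2 ^ k` is avoided. The
-- values `2 ^ j` with `j < k` span everything smaller, and `Cancelling` covers 0.
SG≡2^ : ∀ {n} k → (∀ {x} → Nondivisor n x → bit (SG x) k ≡ 0ℙ) →
        (∀ {j} → j < k → ∃[ x ] Nondivisor n x × SG x ≡ 2 ^ j) →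
        Cancelling n → SG n ≡ 2 ^ k
SG≡2^ {n} k low gen cancel = trans (SG-mex n) (mex-unique avoid reach)
  where
  gen′ : ∀ {j} → j < k → ∃[ i ] i ∈ nondivisors n × SG (toℕ i) ≡ 2 ^ j
  gen′ j<k with x , nd , eq ← gen j<k with i , i∈ , refl ← ∈-nondivisors⁺ nd = i , i∈ , eq

  avoid : 2 ^ k ∉ map (⨊ (SG ∘ toℕ)) (nonemptySubsets (nondivisors n))
  avoid p with S , S∈ , eq ← ∈-map⁻ _ p
    with () ← trans (sym (bit-2^-same k))
                (trans (cong (λ v → bit v k) eq)
                       (bit-⨊ (SG ∘ toℕ) k (nondivisors n) (low ∘ ∈-nondivisors⁻) S∈))

  reach : ∀ {v} → v < 2 ^ k → v ∈ map (⨊ (SG ∘ toℕ)) (nonemptySubsets (nondivisors n))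
  reach {v} v<2^k with Span⇒nonemptySubset _ (Span-bits (SG ∘ toℕ) k gen′ v (<2^⇒bit≡0 k v<2^k))
  ... | inj₁ refl = Cancelling⇒0∈ cancel
  ... | inj₂ v∈   = v∈

-- Heap sizes as doublings of bases

-- The entry 8 starts a family of its own because its half 4 has value 0. From index 4 on, `base j`
-- is `2 * j + 1`, in step with the value `2 ^ j`.
base : ℕ → ℕ
base 0 = 3
base 1 = 5
base 2 = 7
base 3 = 8
base (suc (suc (suc (suc j)))) = suc (2 * (4 + j))

base-step : ∀ j → base j < base (suc j)
base-step 0 = from-yes (3 <? 5)
base-step 1 = from-yes (5 <? 7)
base-step 2 = from-yes (7 <? 8)
base-step 3 = from-yes (8 <? 9)
base-step (suc (suc (suc (suc j)))) = s≤s (*-monoʳ-< 2 (n<1+n (4 + j)))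

base-mono-< : ∀ {i j} → i < j → base i < base j
base-mono-< {i} {suc j} (s≤s i≤j) with m≤n⇒m<n∨m≡n i≤j
... | inj₁ i<j  = <-trans (base-mono-< i<j) (base-step j)
... | inj₂ refl = base-step i

3≤base : ∀ j → 3 ≤ base j
3≤base zero    = ≤-refl
3≤base (suc j) = <⇒≤ (base-mono-< {0} {suc j} z<s)

base≤base*2^ : ∀ j b → base j ≤ base j * 2 ^ b
base≤base*2^ j b = m≤m*n (base j) (2 ^ b) {{m^n≢0 2 b}}

3≤base*2^ : ∀ j b → 3 ≤ base j * 2 ^ b
3≤base*2^ j b = ≤-trans (3≤base j) (base≤base*2^ j b)

2*[a*2^b]≡a*2^suc-b : ∀ a b → 2 * (a * 2 ^ b) ≡ a * 2 ^ suc b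
2*[a*2^b]≡a*2^suc-b a b = begin
  2 * (a * 2 ^ b)   ≡⟨ *-assoc 2 a (2 ^ b) ⟨
  2 * a * 2 ^ b     ≡⟨ cong (_* 2 ^ b) (*-comm 2 a) ⟩
  a * 2 * 2 ^ b     ≡⟨ *-assoc a 2 (2 ^ b) ⟩
  a * 2 ^ suc b     ∎
  where open ≡-Reasoning

base*2^≢4 : ∀ j b → base j * 2 ^ b ≢ 4
base*2^≢4 0 zero ()
base*2^≢4 1 zero ()
base*2^≢4 2 zero ()
base*2^≢4 3 zero ()
base*2^≢4 (suc (suc (suc (suc j)))) zero ()
base*2^≢4 j (suc b) eq = <⇒≢ (3≤base*2^ j b) (sym (*-cancelˡ-≡ _ 2 2 (trans (2*[a*2^b]≡a*2^suc-b (base j) b) eq)))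

odd≢even : ∀ a b → suc (2 * a) ≢ 2 * b
odd≢even a b eq with () ← trans (sym (parity-◃ 1ℙ a)) (trans (cong parity eq) (parity-◃ 0ℙ b))

data Class (x : ℕ) : Set where
  small   : x ∈ 1 ∷ 2 ∷ 4 ∷ [] → Class x
  doubled : ∀ j b → x ≡ base j * 2 ^ b → Class x

-- Even numbers are halved until an odd number remains; on the way back, doubling 4 opens the family
-- of `base 3`.
classify : ∀ x → 1 ≤ x → Class x
classify = <-rec _ step
  where
  odd : ∀ k → Class (suc (2 * k))
  odd 0 = small (here refl)
  odd 1 = doubled 0 0 refl
  odd 2 = doubled 1 0 refl
  odd 3 = doubled 2 0 refl
  odd (suc (suc (suc (suc j)))) = doubled (4 + j) 0 (sym (*-identityʳ _))

  double : ∀ {m} → Class m → Class (2 * m)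
  double (small (here refl))                 = small (there (here refl))
  double (small (there (here refl)))         = small (there (there (here refl)))
  double (small (there (there (here refl)))) = doubled 3 0 refl
  double (doubled j b refl)                  = doubled j (suc b) (2*[a*2^b]≡a*2^suc-b (base j) b)

  step : ∀ x → (∀ {y} → y < x → 1 ≤ y → Class y) → 1 ≤ x → Class x
  step x rec 1≤x with parity x | parity◃half x
  ... | 1ℙ | eq = subst Class (sym eq) (odd ⌊ x /2⌋)
  ... | 0ℙ | eq with ⌊ x /2⌋
  ...   | zero  = contradiction (subst (1 ≤_) eq 1≤x) λ ()
  ...   | suc m = subst Class (sym eq) (double (rec (subst (suc m <_) (sym eq) (m<m+n (suc m) z<s)) z<s))

SG-small : ∀ {x} → x ∈ 1 ∷ 2 ∷ 4 ∷ [] → SG x ≡ 0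
SG-small (here refl)                 = refl
SG-small (there (here refl))         = refl
SG-small (there (there (here refl))) = refl

-- Doublings and divisibility

n<2*n : ∀ {n} → 1 ≤ n → n < 2 * n
n<2*n {n} 1≤n = m<m+n n (≤-trans 1≤n (m≤m+n n 0))

-- As the bound grows by one, the doubling found so far still serves, unless its double has just
-- fallen below the bound and takes over.
greatest-doubling : ∀ {a n} → 1 ≤ a → a < n → ∃[ b ] a * 2 ^ b < n × n ≤ 2 * (a * 2 ^ b)
greatest-doubling {a} {suc n} 1≤a (s≤s a≤n) with m≤n⇒m<n∨m≡n a≤n
... | inj₂ refl = 0 , s≤s (≤-reflexive (*-identityʳ a)) ,
  subst (suc a ≤_) (cong (2 *_) (sym (*-identityʳ a))) (n<2*n 1≤a)
... | inj₁ a<n with b , lt , le ← greatest-doubling 1≤a a<n with m≤n⇒m<n∨m≡n le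
...   | inj₁ n<2x = b , m<n⇒m<1+n lt , n<2x
...   | inj₂ n≡2x = suc b , s≤s (≤-reflexive (sym n≡2y)) , subst (λ v → suc n ≤ 2 * v) n≡2y (n<2*n (≤-trans 1≤a a≤n))
  where
  n≡2y : n ≡ a * 2 ^ suc b
  n≡2y = trans n≡2x (2*[a*2^b]≡a*2^suc-b a b)

proper-divisor⇒2* : ∀ {x n} → x ∣ n → x < n → n ≤ 2 * x → n ≡ 2 * x
proper-divisor⇒2* (divides 0 refl)               ()  _
proper-divisor⇒2* {x} (divides 1 refl)           lt  _  = contradiction lt (<-irrefl (sym (*-identityˡ x)))
proper-divisor⇒2* {x} (divides (suc (suc q)) refl) lt le = ≤-antisym le (*-monoˡ-≤ x (s≤s (s≤s (z≤n {q}))))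

*2^-<⇒∣ : ∀ a b c → a * 2 ^ b < a * 2 ^ c → a * 2 ^ b ∣ a * 2 ^ c
*2^-<⇒∣ a b c lt = *-monoʳ-∣ a (divides (2 ^ (c ∸ b)) (begin
  2 ^ c                     ≡⟨ cong (2 ^_) (m∸n+n≡m b≤c) ⟨
  2 ^ (c ∸ b + b)           ≡⟨ ^-distribˡ-+-* 2 (c ∸ b) b ⟩
  2 ^ (c ∸ b) * 2 ^ b       ∎))
  where
  open ≡-Reasoning
  b≤c : b ≤ c
  b≤c = ≮⇒≥ λ c<b → <⇒≱ lt (*-monoʳ-≤ a (^-monoʳ-≤ 2 (<⇒≤ c<b)))

-- Strong induction on `n`. The factorisation is an equation, so the induction hypothesis applies to
-- any way of writing a smaller number.
SG-base*2^ : ∀ n j b → n ≡ base j * 2 ^ b → SG n ≡ 2 ^ j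
SG-base*2^ = <-rec _ step
  where
  step : ∀ n → (∀ {x} → x < n → ∀ j b → x ≡ base j * 2 ^ b → SG x ≡ 2 ^ j) →
         ∀ j b → n ≡ base j * 2 ^ b → SG n ≡ 2 ^ j
  step n rec j b n≡ = SG≡2^ j low gen cancel
    where
    3≤n : 3 ≤ n
    3≤n = subst (3 ≤_) (sym n≡) (3≤base*2^ j b)

    low : ∀ {x} → Nondivisor n x → bit (SG x) j ≡ 0ℙ
    low {x} nd with classify x (positive nd)
    ... | small x∈ = trans (cong (λ v → bit v j) (SG-small x∈)) (bit-zero j)
    ... | doubled i c x≡ with i ≟ j
    ...   | no i≢j = trans (cong (λ v → bit v j) (rec (smaller nd) i c x≡)) (bit-2^-other i j i≢j)
    ...   | yes refl = contradiction
      (subst₂ _∣_ (sym x≡) (sym n≡) (*2^-<⇒∣ (base j) c b (subst₂ _<_ x≡ n≡ (smaller nd)))) (nondivides nd)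

    not-double : ∀ {i c x} → i < j → x ≡ base i * 2 ^ c → x < n → n ≢ 2 * x
    not-double {i} {c} {x} i<j x≡ x<n n≡2x = same-class b j refl refl
      where
      base≡2x : ∀ {j′} → b ≡ 0 → j ≡ j′ → base j′ ≡ 2 * x
      base≡2x refl refl = trans (sym (*-identityʳ (base j))) (trans (sym n≡) n≡2x)

      same-class : ∀ b′ j′ → b ≡ b′ → j ≡ j′ → ⊥
      -- Here `x` is also a doubling of `base j`, so the induction hypothesis gives it both values
      -- `2 ^ i` and `2 ^ j`. Uniqueness of the base thus needs no separate proof.
      same-class (suc b′) _ refl _ = <⇒≢ i<j (2^-injective
        (trans (sym (rec x<n i c x≡)) (rec x<n j b′ (*-cancelˡ-≡ x _ 2 (trans (sym n≡2x) (trans n≡ (sym (2*[a*2^b]≡a*2^suc-b (base j) b′))))))))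
      same-class zero 0 p q = contradiction (subst (i <_) q i<j) λ ()
      same-class zero 1 p q = odd≢even 2 x (base≡2x p q)
      same-class zero 2 p q = odd≢even 3 x (base≡2x p q)
      -- The only even base is 8, and its half 4 is no doubling of a base.
      same-class zero 3 p q = base*2^≢4 i c (trans (sym x≡) (sym (*-cancelˡ-≡ 4 x 2 (base≡2x p q))))
      same-class zero (suc (suc (suc (suc k)))) p q = odd≢even (4 + k) x (base≡2x p q)

    gen : ∀ {i} → i < j → ∃[ x ] Nondivisor n x × SG x ≡ 2 ^ i
    gen {i} i<j with c , x<n , n≤2x ← greatest-doubling (≤-trans (s≤s z≤n) (3≤base i))
                       (<-≤-trans (base-mono-< i<j) (subst (base j ≤_) (sym n≡) (base≤base*2^ j b))) =
      base i * 2 ^ c ,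
      nondivisor (≤-trans (s≤s z≤n) (3≤base*2^ i c)) x<n
        (λ x∣n → not-double {c = c} i<j refl x<n (proper-divisor⇒2* x∣n x<n n≤2x)) ,
      rec x<n i c refl

    even-cancel : ∀ p → n ≡ 2 * suc p → Class p → Cancelling n
    -- The small values 1, 2 and 4 of `p` give `n` equal to 4, 6 and 10.
    even-cancel p eq (small (here refl)) = contradiction (trans (sym n≡) eq) (base*2^≢4 j b)
    even-cancel p eq (small (there (here refl))) =
      zero-option 4 (subst (λ v → Nondivisor v 4) (sym eq) (nondivisor (s≤s z≤n) (from-yes (4 <? 6)) (from-no (4 ∣? 6)))) refl
    even-cancel p eq (small (there (there (here refl)))) =
      zero-option 4 (subst (λ v → Nondivisor v 4) (sym eq) (nondivisor (s≤s z≤n) (from-yes (4 <? 10)) (from-no (4 ∣? 10)))) refl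
    even-cancel p eq (doubled i c p≡) = equal-pair p (2 * p)
      (<⇒≢ p<2p)
      -- Since `n` is `2 * p + 2`, a divisor `p` or `2 * p` of `n` would divide 2, yet both are at
      -- least 3.
      (nondivisor 1≤p (<-trans p<2p 2p<n) λ p∣n → <⇒≱ 3≤p (∣⇒≤ (∣m+n∣m⇒∣n (subst (p ∣_) n≡2p+2 p∣n) (n∣m*n 2))))
      (nondivisor (≤-trans 1≤p (<⇒≤ p<2p)) 2p<n
        λ 2p∣n → <⇒≱ (<-trans 3≤p p<2p) (∣⇒≤ (∣m+n∣m⇒∣n (subst (2 * p ∣_) n≡2p+2 2p∣n) ∣-refl)))
      (trans (rec (<-trans p<2p 2p<n) i c p≡)
        (sym (rec 2p<n i (suc c) (trans (cong (2 *_) p≡) (2*[a*2^b]≡a*2^suc-b (base i) c)))))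
      where
      3≤p : 3 ≤ p
      3≤p = subst (3 ≤_) (sym p≡) (3≤base*2^ i c)
      1≤p : 1 ≤ p
      1≤p = ≤-trans (s≤s z≤n) 3≤p
      p<2p : p < 2 * p
      p<2p = n<2*n 1≤p
      n≡2p+2 : n ≡ 2 * p + 2
      n≡2p+2 = trans eq (trans (2*-suc p) (+-comm 2 (2 * p)))
      2p<n : 2 * p < n
      2p<n = subst (2 * p <_) (sym n≡2p+2) (m<m+n (2 * p) z<s)

    cancel : Cancelling n
    cancel with parity n | parity◃half n
    ... | 1ℙ | eq = zero-option 2
      (nondivisor (s≤s z≤n) 3≤n λ { (divides q n≡q*2) → odd≢even ⌊ n /2⌋ q (trans (sym eq) (trans n≡q*2 (*-comm q 2))) }) refl
    ... | 0ℙ | eq with ⌊ n /2⌋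
    ...   | 0           = contradiction (subst (3 ≤_) eq 3≤n) λ ()
    ...   | 1           = contradiction (subst (3 ≤_) eq 3≤n) (from-no (3 ≤? 2))
    ...   | suc (suc p) = even-cancel (suc p) eq (classify (suc p) z<s)

mainTheorem16 : (map SG (1 ∷ 2 ∷ 3 ∷ 4 ∷ 5 ∷ 6 ∷ 7 ∷ 8 ∷ []) ≡ 0 ∷ 0 ∷ 1 ∷ 0 ∷ 2 ∷ 1 ∷ 4 ∷ 8 ∷ [])
    × ((n k : ℕ) → n ≡ 2 * k + 1 → 4 ≤ k → SG n ≡ 2 ^ k)
    × ((n : ℕ) → 10 ≤ n → 2 ∣ n → SG n ≡ SG (n / 2))
mainTheorem16 = first-eight , odd , even
  where
  first-eight : map SG (1 ∷ 2 ∷ 3 ∷ 4 ∷ 5 ∷ 6 ∷ 7 ∷ 8 ∷ []) ≡ 0 ∷ 0 ∷ 1 ∷ 0 ∷ 2 ∷ 1 ∷ 4 ∷ 8 ∷ []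
  -- The sizes 1, 2 and 4 are settled by evaluation, the others by the closed form; 6 is `base 0`
  -- doubled once.
  first-eight =
    cong₂ _∷_ refl (cong₂ _∷_ refl (cong₂ _∷_ (SG-base*2^ 3 0 0 refl) (cong₂ _∷_ refl
    (cong₂ _∷_ (SG-base*2^ 5 1 0 refl) (cong₂ _∷_ (SG-base*2^ 6 0 1 refl)
    (cong₂ _∷_ (SG-base*2^ 7 2 0 refl) (cong₂ _∷_ (SG-base*2^ 8 3 0 refl) refl)))))))

  odd : (n k : ℕ) → n ≡ 2 * k + 1 → 4 ≤ k → SG n ≡ 2 ^ k
  -- Four constructors must be exposed for `base k` to reduce to `suc (2 * k)`.
  odd n k@(suc (suc (suc (suc _)))) n≡ (s≤s (s≤s (s≤s (s≤s z≤n)))) =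
    SG-base*2^ n k 0 (trans n≡ (trans (+-comm (2 * k) 1) (sym (*-identityʳ _))))

  even : (n : ℕ) → 10 ≤ n → 2 ∣ n → SG n ≡ SG (n / 2)
  even _ 10≤n (divides m refl) = trans (even′ (*-cancelʳ-≤ 5 m 2 10≤n)) (cong SG (sym (m*n/n≡m m 2)))
    where
    even′ : 5 ≤ m → SG (m * 2) ≡ SG m
    even′ 5≤m with classify m (≤-trans (s≤s z≤n) 5≤m)
    ... | small (here refl)                 = contradiction 5≤m (from-no (5 ≤? 1))
    ... | small (there (here refl))         = contradiction 5≤m (from-no (5 ≤? 2))
    ... | small (there (there (here refl))) = contradiction 5≤m (from-no (5 ≤? 4))
    ... | doubled j b m≡ = trans
      (SG-base*2^ (m * 2) j (suc b) (trans (*-comm m 2) (trans (cong (2 *_) m≡) (2*[a*2^b]≡a*2^suc-b (base j) b))))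
      (sym (SG-base*2^ m j b m≡))
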